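{- Let $\mathbb{P}_\tau=(P_o,P_a,\vDash,\mathcal{F}_\tau)$ be an attribute continuous formal context. Then $(\mathfrak{B}(P_a,\mathcal{F}_\tau),\subseteq)$ is an algebraic domain if and only if the following condition holds: for all $F_1,F_2\in\mathcal{F}_\tau$ with $F_2\subseteq\lceil F_1\rceil$ there exists $F\in\mathcal{F}_\tau$ such that $F_2\subseteq\lceil F\rceil$, $F\subseteq\lceil F\rceil$ and $F\subseteq\lceil F_1\rceil$.
   Context: Domain theory. A dcpo is a poset in which every directed (nonempty, upward directed) subset has a least upper bound. In a dcpo $P$, $x\ll y$ means: for every directed $D\subseteq P$ with $y\leq\bigvee D$ there is $d\in D$ with $x\leq d$. A basis of $P$ is a subset $B\subseteq P$ such that for every $x\in P$ the set $\{b\in B: b\ll x\}$ is directed with least upper bound $x$. An element $x$ is compact if $x\ll x$. A dcpo is an algebraic domain if its set of compact elements is a basis. Notation: $M\sqsubseteq X$ means that $M$ is a finite subset of $X$ (possibly empty). A formal context is a triple $(P_o,P_a,\vDash)$ with sets $P_o$ (objects), $P_a$ (attributes) and a relation $\vDash\subseteq P_o\times P_a$. Define $\alpha(A)=\{n\in P_a:\forall m\in A,\ m\vDash n\}$ for $A\subseteq P_o$ and $\omega(B)=\{m\in P_o:\forall n\in B,\ m\vDash n\}$ for $B\subseteq P_a$. A kernel attribute operator on $(P_o,P_a,\vDash)$ is a map $\tau:\mathcal{P}(P_a)\to\mathcal{P}(P_a)$ such that for all $B,B_1\subseteq P_a$: $\tau(\alpha(\omega(B)))\subseteq\alpha(\omega(B))$;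 $\tau(\tau(\alpha(\omega(B))))=\tau(\alpha(\omega(B)))$; and $\tau(\alpha(\omega(B)))\subseteq\tau(\alpha(\omega(B_1)))$ whenever $B\subseteq B_1$. Write $\lceil B\rceil=\tau(\alpha(\omega(B)))$. A $\tau$-consistent selection is a nonempty family $\mathcal{F}_\tau$ of nonempty finite subsets of $P_a$ such that for every $F\in\mathcal{F}_\tau$ and every $M\sqsubseteq\lceil F\rceil$ there is $G\in\mathcal{F}_\tau$ with $M\subseteq\lceil G\rceil$ and $G\subseteq\lceil F\rceil$. An attribute continuous formal context is a structure $\mathbb{P}_\tau=(P_o,P_a,\vDash,\mathcal{F}_\tau)$ where $(P_o,P_a,\vDash)$ is a formal context, $\tau$ is a kernel attribute operator on it and $\mathcal{F}_\tau$ is a $\tau$-consistent selection. A continuous formal concept of $\mathbb{P}_\tau$ is a subset $Q\subseteq P_a$ such that for every $M\sqsubseteq Q$ there is $F\in\mathcal{F}_\tau$ with $M\subseteq\lceil F\rceil\subseteq Q$. The set of all of them is $\mathfrak{B}(P_a,\mathcal{F}_\tau)$. -}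

module Defs where

open import Data.List.Base using (List; [])
import Data.List.Membership.Propositional as List
open import Data.Product.Base using (∃-syntax; _×_; proj₁)
open import Level using (Level; suc; _⊔_)
open import Relation.Binary.Bundles using (Poset)
import Relation.Binary.Construct.On as On
open import Relation.Binary.PropositionalEquality.Core using (_≢_)
open import Relation.Unary using (Pred; _∈_; _⊆_; _∩_; _≐_; Satisfiable)
open import Relation.Unary.Relation.Binary.Subset using (⊆-poset)

private
  variable
    c ℓ ℓ₁ ℓ₂ : Level

-- A subset of P is a predicate on its carrier, and the power set of
-- P is Pred Carrier c; under excluded middle every predicate is equivalent to
-- one of this level, so the choice of c is immaterial there.  Directed and
-- IsLub are level-polymorphic because _≪ x lives in a higher universe.

module Domain (P : Poset c ℓ₁ ℓ₂) where

  open Poset P using (Carrier; _≤_)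

  Directed : ∀ {d} → Pred Carrier d → Set _
  Directed D =
    Satisfiable D ×
    (∀ {x y} → x ∈ D → y ∈ D → ∃[ z ] z ∈ D × x ≤ z × y ≤ z)

  IsLub : ∀ {d} → Pred Carrier d → Carrier → Set _
  IsLub D s =
    (∀ {x} → x ∈ D → x ≤ s) ×
    (∀ u → (∀ {x} → x ∈ D → x ≤ u) → s ≤ u)

  IsDcpo : Set _
  IsDcpo = (D : Pred Carrier c) → Directed D → ∃[ s ] IsLub D s

  -- "y ≤ ⋁ D" is stated for any s that is a least upper bound of D; such an s
  -- exists in a dcpo and is unique up to the equality of P.

  _≪_ : Carrier → Carrier → Set _
  x ≪ y =
    (D : Pred Carrier c) → Directed D →
    ∀ s → IsLub D s → y ≤ s → ∃[ d ] d ∈ D × x ≤ d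

  IsBasis : ∀ {b} → Pred Carrier b → Set _
  IsBasis B =
    ∀ x → Directed (B ∩ (_≪ x)) × IsLub (B ∩ (_≪ x)) x

  Compact : Pred Carrier _
  Compact x = x ≪ x

  record IsAlgebraicDomain : Set (suc c ⊔ ℓ₁ ⊔ ℓ₂) where
    field
      isDcpo       : IsDcpo
      compactBasis : IsBasis Compact

open Domain public using (IsAlgebraicDomain)

record FormalContext (ℓ : Level) : Set (suc ℓ) where
  field
    Pₒ  : Set ℓ
    Pₐ  : Set ℓ
    _⊨_ : Pₒ → Pₐ → Set ℓ

  α : Pred Pₒ ℓ → Pred Pₐ ℓ
  α A n = ∀ m → m ∈ A → m ⊨ n

  ω : Pred Pₐ ℓ → Pred Pₒ ℓ
  ω B m = ∀ n → n ∈ B → m ⊨ n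

-- Subsets are predicates compared by _≐_, so a map on the power set must come
-- with a proof that it respects _≐_.

record KernelAttributeOperator (K : FormalContext ℓ) : Set (suc ℓ) where
  open FormalContext K
  field
    τ             : Pred Pₐ ℓ → Pred Pₐ ℓ
    τ-cong        : ∀ {B B₁} → B ≐ B₁ → τ B ≐ τ B₁
    τ-contractive : ∀ B → τ (α (ω B)) ⊆ α (ω B)
    τ-idempotent  : ∀ B → τ (τ (α (ω B))) ≐ τ (α (ω B))
    τ-monotone    : ∀ {B B₁} → B ⊆ B₁ → τ (α (ω B)) ⊆ τ (α (ω B₁))

  ⌈_⌉ : Pred Pₐ ℓ → Pred Pₐ ℓ
  ⌈ B ⌉ = τ (α (ω B))

-- A finite subset is presented by a list enumerating it, in any order and with
-- repetitions allowed; ⟦ F ⟧ is the subset enumerated by F.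

⟦_⟧ : {A : Set ℓ} → List A → Pred A ℓ
⟦ F ⟧ x = x List.∈ F

-- 𝓕 stands for the family of all subsets ⟦ F ⟧ with F ∈ 𝓕.  It need not be closed
-- under changing the enumeration F of a subset, as only ⟦ F ⟧ is ever used.

record ConsistentSelection {K : FormalContext ℓ}
                           (T : KernelAttributeOperator K) : Set (suc ℓ) where
  open FormalContext K
  open KernelAttributeOperator T
  field
    𝓕            : Pred (List Pₐ) ℓ
    𝓕-nonempty   : Satisfiable 𝓕
    𝓕-members    : ∀ {F} → F ∈ 𝓕 → F ≢ []
    𝓕-consistent :
      ∀ {F} → F ∈ 𝓕 → ∀ M → ⟦ M ⟧ ⊆ ⌈ ⟦ F ⟧ ⌉ →
      ∃[ G ] G ∈ 𝓕 × ⟦ M ⟧ ⊆ ⌈ ⟦ G ⟧ ⌉ × ⟦ G ⟧ ⊆ ⌈ ⟦ F ⟧ ⌉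

record AttributeContinuousContext (ℓ : Level) : Set (suc ℓ) where
  field
    formalContext       : FormalContext ℓ
    kernelOperator      : KernelAttributeOperator formalContext
    consistentSelection : ConsistentSelection kernelOperator

  open FormalContext formalContext public
  open KernelAttributeOperator kernelOperator public
  open ConsistentSelection consistentSelection public

  IsContinuousConcept : Pred Pₐ ℓ → Set ℓ
  IsContinuousConcept Q =
    ∀ M → ⟦ M ⟧ ⊆ Q →
    ∃[ F ] F ∈ 𝓕 × ⟦ M ⟧ ⊆ ⌈ ⟦ F ⟧ ⌉ × ⌈ ⟦ F ⟧ ⌉ ⊆ Q

  -- 𝔅(Pₐ, 𝓕) ordered by inclusion, with equality _≐_.

  𝔅 : Poset (suc ℓ) ℓ ℓ
  𝔅 = On.poset (⊆-poset Pₐ ℓ) (proj₁ {B = IsContinuousConcept})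

{-# OPTIONS --safe #-}
-- Closing up under ⌈_⌉ gives ⌈ G ⌉ ⊆ ⌈ F ⌉ as soon as G ⊆ ⌈ F ⌉.  Hence every ⌈ F ⌉ with
-- F ∈ 𝓕 is a concept, directed suprema of concepts are unions, and Q₁ ≪ Q₂ holds
-- exactly when Q₁ ⊆ ⌈ F ⌉ for some F ∈ 𝓕 with F ⊆ Q₂ (written Q₁ ◁ Q₂ below).  The
-- compact concepts are thus the ⌈ F ⌉ with F ∈ 𝓕 and F ⊆ ⌈ F ⌉, and the condition of
-- the theorem says that they interpolate below every ⌈ F₁ ⌉.
module Submission where

open import Axiom.ExcludedMiddle using (ExcludedMiddle)
open import Data.Unit.Base using (⊤; tt)
open import Data.List.Base using ([]; _∷_; _++_)
open import Data.List.Membership.Propositional.Properties using (∈-++⁺ˡ; ∈-++⁺ʳ; ∈-++⁻)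
open import Data.List.Relation.Unary.Any using (here; there)
open import Data.Product.Base using (Σ-syntax; ∃-syntax; _×_; _,_; proj₁; proj₂)
open import Data.Sum.Base using ([_,_])
open import Function.Base using (id; _∘_)
open import Function.Bundles using (_⇔_; mk⇔)
open import Level using (Level; suc; Lift; lift)
open import Relation.Binary.Bundles using (Poset)
open import Relation.Binary.PropositionalEquality.Core using (refl)
open import Relation.Nullary.Decidable.Core using (True; toWitness; fromWitness)
open import Relation.Unary using (Pred; _∈_; _⊆_; _∩_)
open import Defs

module _ {c ℓ₁ ℓ₂ d e} {P : Poset c ℓ₁ ℓ₂}
         {D : Pred (Poset.Carrier P) d} {E : Pred (Poset.Carrier P) e}
         (D⊆E : D ⊆ E) (E⊆D : E ⊆ D) where

  open Domain P

  -- The levels of `D` and `E` may differ, so a family cut out by `_≪_` can be traded for one in a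
  -- lower universe.
  Directed-resp-≐ : Directed D → Directed E
  Directed-resp-≐ ((x , x∈D) , ub) = (x , D⊆E x∈D) , λ x∈E y∈E →
    let z , z∈D , x≤z , y≤z = ub (E⊆D x∈E) (E⊆D y∈E) in z , D⊆E z∈D , x≤z , y≤z

  IsLub-resp-≐ : ∀ {s} → IsLub D s → IsLub E s
  IsLub-resp-≐ (upper , least) = upper ∘ E⊆D , λ u bound → least u (bound ∘ D⊆E)

module Concepts {ℓ} (em : ExcludedMiddle (suc ℓ)) (ℙ : AttributeContinuousContext ℓ) where

  open AttributeContinuousContext ℙ
  open Poset 𝔅 using () renaming (Carrier to Concept)
  open Domain 𝔅 hiding (IsAlgebraicDomain)

  -- Contractivity puts `C` inside `α (ω B)`; monotonicity and the Galois identity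
  -- `α (ω (α (ω B))) ≐ α (ω B)` do the rest.
  ⌈⌉-least : ∀ {B C} → C ⊆ ⌈ B ⌉ → ⌈ C ⌉ ⊆ ⌈ B ⌉
  ⌈⌉-least {B} {C} C⊆⌈B⌉ =
    proj₁ (τ-cong ( (λ h m m∈ωB → h m (λ n n∈αωB → n∈αωB m m∈ωB))
                  , (λ h m m∈ωαωB → h m (λ n n∈B → m∈ωαωB n (λ m′ m′∈ωB → m′∈ωB n n∈B)))))
    ∘ τ-monotone (τ-contractive B ∘ C⊆⌈B⌉)

  ⌈⌉-concept : ∀ {F} → F ∈ 𝓕 → Concept
  ⌈⌉-concept {F} F∈𝓕 = ⌈ ⟦ F ⟧ ⌉ , λ M M⊆ →
    let G , G∈𝓕 , M⊆⌈G⌉ , G⊆⌈F⌉ = 𝓕-consistent F∈𝓕 M M⊆ in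
    G , G∈𝓕 , M⊆⌈G⌉ , ⌈⌉-least G⊆⌈F⌉

  ⌈⌉⊆concept : ∀ {F} (Q : Concept) → ⟦ F ⟧ ⊆ proj₁ Q → ⌈ ⟦ F ⟧ ⌉ ⊆ proj₁ Q
  ⌈⌉⊆concept {F} (_ , isQ) F⊆Q =
    let G , _ , F⊆⌈G⌉ , ⌈G⌉⊆Q = isQ F F⊆Q in ⌈G⌉⊆Q ∘ ⌈⌉-least F⊆⌈G⌉

  -- Since `F` need not lie in `⌈ ⟦ F ⟧ ⌉`, consistency is invoked to find a generator that lies in
  -- `Q` itself.
  approximate : ∀ (Q : Concept) M → ⟦ M ⟧ ⊆ proj₁ Q →
                ∃[ F ] F ∈ 𝓕 × ⟦ M ⟧ ⊆ ⌈ ⟦ F ⟧ ⌉ × ⟦ F ⟧ ⊆ proj₁ Q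
  approximate (_ , isQ) M M⊆Q =
    let F , F∈𝓕 , M⊆⌈F⌉ , ⌈F⌉⊆Q = isQ M M⊆Q
        G , G∈𝓕 , M⊆⌈G⌉ , G⊆⌈F⌉ = 𝓕-consistent F∈𝓕 M M⊆⌈F⌉
    in G , G∈𝓕 , M⊆⌈G⌉ , ⌈F⌉⊆Q ∘ G⊆⌈F⌉

  -- The union of a family of concepts lives one universe too high; excluded
  -- middle brings it back down.
  ⋃ : Pred Concept (suc ℓ) → Pred Pₐ ℓ
  ⋃ D a = Lift ℓ (True (em {Σ[ Q ∈ Concept ] Q ∈ D × a ∈ proj₁ Q}))

  ∈-⋃⁺ : ∀ {D a} (Q : Concept) → Q ∈ D → a ∈ proj₁ Q → a ∈ ⋃ D
  ∈-⋃⁺ Q Q∈D a∈Q = lift (fromWitness (Q , Q∈D , a∈Q))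

  ∈-⋃⁻ : ∀ {D a} → a ∈ ⋃ D → Σ[ Q ∈ Concept ] Q ∈ D × a ∈ proj₁ Q
  ∈-⋃⁻ (lift h) = toWitness h

  finite⊆⋃ : ∀ {D} → Directed D → ∀ M → ⟦ M ⟧ ⊆ ⋃ D → Σ[ Q ∈ Concept ] Q ∈ D × ⟦ M ⟧ ⊆ proj₁ Q
  finite⊆⋃ ((Q , Q∈D) , _) [] _ = Q , Q∈D , λ ()
  finite⊆⋃ dir@(_ , ub) (a ∷ M) aM⊆ =
    let Q₁ , Q₁∈D , a∈Q₁ = ∈-⋃⁻ (aM⊆ (here refl))
        Q₂ , Q₂∈D , M⊆Q₂ = finite⊆⋃ dir M (aM⊆ ∘ there)
        Q , Q∈D , Q₁⊆Q , Q₂⊆Q = ub {Q₁} {Q₂} Q₁∈D Q₂∈D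
    in Q , Q∈D , λ { (here refl) → Q₁⊆Q a∈Q₁ ; (there a∈M) → Q₂⊆Q (M⊆Q₂ a∈M) }

  ⋃-concept : ∀ {D} → Directed D → Concept
  ⋃-concept {D} dir = ⋃ D , λ M M⊆ →
    let Q , Q∈D , M⊆Q = finite⊆⋃ dir M M⊆
        F , F∈𝓕 , M⊆⌈F⌉ , ⌈F⌉⊆Q = proj₂ Q M M⊆Q
    in F , F∈𝓕 , M⊆⌈F⌉ , ∈-⋃⁺ Q Q∈D ∘ ⌈F⌉⊆Q

  𝔅-isDcpo : IsDcpo
  𝔅-isDcpo D dir =
    ⋃-concept dir ,
    (λ {Q} Q∈D → ∈-⋃⁺ Q Q∈D) ,
    λ u bound a∈⋃ → let Q , Q∈D , a∈Q = ∈-⋃⁻ a∈⋃ in bound {Q} Q∈D a∈Q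

  -- The union is a concept bounding `D`, so it contains any least upper bound `s`.
  finite⊆lub : ∀ {D} → Directed D → ∀ s → IsLub D s → ∀ M → ⟦ M ⟧ ⊆ proj₁ s →
               Σ[ Q ∈ Concept ] Q ∈ D × ⟦ M ⟧ ⊆ proj₁ Q
  finite⊆lub dir s (_ , least) M M⊆s =
    finite⊆⋃ dir M (least (⋃-concept dir) (λ {Q} Q∈D → ∈-⋃⁺ Q Q∈D) ∘ M⊆s)

  _◁_ : Concept → Concept → Set ℓ
  Q₁ ◁ Q₂ = ∃[ F ] F ∈ 𝓕 × proj₁ Q₁ ⊆ ⌈ ⟦ F ⟧ ⌉ × ⟦ F ⟧ ⊆ proj₁ Q₂

  ◁⇒⊆ : ∀ Q₁ Q₂ → Q₁ ◁ Q₂ → proj₁ Q₁ ⊆ proj₁ Q₂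
  ◁⇒⊆ _ Q₂ (F , _ , Q₁⊆⌈F⌉ , F⊆Q₂) = ⌈⌉⊆concept Q₂ F⊆Q₂ ∘ Q₁⊆⌈F⌉

  module _ {b} {B : Pred Concept b} (Q : Concept)
           (enough : ∀ M → ⟦ M ⟧ ⊆ proj₁ Q →
                     Σ[ K ∈ Concept ] K ∈ B × K ◁ Q × ⟦ M ⟧ ⊆ proj₁ K) where

    -- Two generators inside `Q` concatenate to one finite subset, which `enough` encloses in a
    -- member of `B`. Below, `B` is first the family of all concepts, later that of the compact
    -- ones.
    ◁-directed : Directed (B ∩ (_◁ Q))
    ◁-directed =
      (let K , K∈B , K◁Q , _ = enough [] (λ ()) in K , K∈B , K◁Q) ,
      λ { (_ , F₁ , _ , K₁⊆⌈F₁⌉ , F₁⊆Q) (_ , F₂ , _ , K₂⊆⌈F₂⌉ , F₂⊆Q) →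
        let K , K∈B , K◁Q , F₁F₂⊆K = enough (F₁ ++ F₂) ([ F₁⊆Q , F₂⊆Q ] ∘ ∈-++⁻ F₁)
        in K , (K∈B , K◁Q) ,
           ⌈⌉⊆concept K (F₁F₂⊆K ∘ ∈-++⁺ˡ) ∘ K₁⊆⌈F₁⌉ ,
           ⌈⌉⊆concept K (F₁F₂⊆K ∘ ∈-++⁺ʳ F₁) ∘ K₂⊆⌈F₂⌉ }

    ◁-isLub : IsLub (B ∩ (_◁ Q)) Q
    ◁-isLub =
      (λ {K} (_ , K◁Q) → ◁⇒⊆ K Q K◁Q) ,
      λ u bound {a} a∈Q →
        let K , K∈B , K◁Q , a⊆K = enough (a ∷ []) (λ { (here refl) → a∈Q })
        in bound {K} (K∈B , K◁Q) (a⊆K (here refl))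

  -- The generator is finite, so a single member of `D` already contains it.
  ◁⇒≪ : ∀ {Q₁ Q₂} → Q₁ ◁ Q₂ → Q₁ ≪ Q₂
  ◁⇒≪ (F , _ , Q₁⊆⌈F⌉ , F⊆Q₂) D dir s lub Q₂⊆s =
    let Q , Q∈D , F⊆Q = finite⊆lub dir s lub F (Q₂⊆s ∘ F⊆Q₂)
    in Q , Q∈D , ⌈⌉⊆concept Q F⊆Q ∘ Q₁⊆⌈F⌉

  -- It suffices to test `Q₁ ≪ Q₂` on the concepts `◁ Q₂`, which form a directed family with
  -- supremum `Q₂`.
  ≪⇒◁ : ∀ {Q₁ Q₂} → Q₁ ≪ Q₂ → Q₁ ◁ Q₂
  ≪⇒◁ {_} {Q₂} Q₁≪Q₂ =
    let Q , (_ , F , F∈𝓕 , Q⊆⌈F⌉ , F⊆Q₂) , Q₁⊆Q =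
          Q₁≪Q₂ (U ∩ (_◁ Q₂)) (◁-directed Q₂ enough) Q₂ (◁-isLub Q₂ enough) id
    in F , F∈𝓕 , Q⊆⌈F⌉ ∘ Q₁⊆Q , F⊆Q₂
    where
    -- The lift brings `U ∩ (_◁ Q₂)` to the level over which `_≪_` quantifies.
    U : Pred Concept (suc ℓ)
    U _ = Lift (suc ℓ) ⊤

    enough : ∀ M → ⟦ M ⟧ ⊆ proj₁ Q₂ → Σ[ K ∈ Concept ] K ∈ U × K ◁ Q₂ × ⟦ M ⟧ ⊆ proj₁ K
    enough M M⊆Q₂ =
      let F , F∈𝓕 , M⊆⌈F⌉ , F⊆Q₂ = approximate Q₂ M M⊆Q₂
      in ⌈⌉-concept F∈𝓕 , lift tt , (F , F∈𝓕 , id , F⊆Q₂) , M⊆⌈F⌉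

  Interpolation : Set ℓ
  Interpolation =
    ∀ F₁ F₂ → F₁ ∈ 𝓕 → F₂ ∈ 𝓕 → ⟦ F₂ ⟧ ⊆ ⌈ ⟦ F₁ ⟧ ⌉ →
    ∃[ F ] F ∈ 𝓕 × ⟦ F₂ ⟧ ⊆ ⌈ ⟦ F ⟧ ⌉ × ⟦ F ⟧ ⊆ ⌈ ⟦ F ⟧ ⌉ × ⟦ F ⟧ ⊆ ⌈ ⟦ F₁ ⟧ ⌉

  -- The finite set `F₂` falls into one compact `K` below `⌈ ⟦ F₁ ⟧ ⌉`, and `K ◁ K` supplies `F`
  -- with `⟦ F ⟧ ⊆ K ⊆ ⌈ ⟦ F ⟧ ⌉`.
  algebraic⇒interpolation : IsAlgebraicDomain 𝔅 → Interpolation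
  algebraic⇒interpolation alg F₁ F₂ F₁∈𝓕 _ F₂⊆⌈F₁⌉ =
    let Q = ⌈⌉-concept F₁∈𝓕
        dir , lub = IsAlgebraicDomain.compactBasis alg Q
        -- Same family as Compact ∩ (_≪ Q), in the universe that ⋃ can handle.
        D = λ K → Lift (suc ℓ) (K ◁ K × K ◁ Q)
        to : Compact ∩ (_≪ Q) ⊆ D
        to = λ {K} (K≪K , K≪Q) → lift (≪⇒◁ {K} {K} K≪K , ≪⇒◁ {K} {Q} K≪Q)
        from : D ⊆ Compact ∩ (_≪ Q)
        from = λ {K} (lift (K◁K , K◁Q)) → ◁⇒≪ {K} {K} K◁K , ◁⇒≪ {K} {Q} K◁Q
        K , lift ((F , F∈𝓕 , K⊆⌈F⌉ , F⊆K) , K◁Q) , F₂⊆K =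
          finite⊆lub (Directed-resp-≐ {P = 𝔅} (λ {K} → to {K}) (λ {K} → from {K}) dir)
                     Q (IsLub-resp-≐ {P = 𝔅} (λ {K} → to {K}) (λ {K} → from {K}) {Q} lub)
                     F₂ F₂⊆⌈F₁⌉
    in F , F∈𝓕 , K⊆⌈F⌉ ∘ F₂⊆K , K⊆⌈F⌉ ∘ F⊆K , ◁⇒⊆ K Q K◁Q ∘ F⊆K

  interpolation⇒algebraic : Interpolation → IsAlgebraicDomain 𝔅
  interpolation⇒algebraic interpolate = record
    { isDcpo       = 𝔅-isDcpo
    ; compactBasis = λ Q →
        Directed-resp-≐ {P = 𝔅} (λ {K} → to Q {K}) (λ {K} → from Q {K}) (◁-directed Q (enough Q)) ,
        IsLub-resp-≐ {P = 𝔅} (λ {K} → to Q {K}) (λ {K} → from Q {K}) {Q} (◁-isLub Q (enough Q))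
    }
    where
    to : ∀ Q → Compact ∩ (_◁ Q) ⊆ Compact ∩ (_≪ Q)
    to Q {K} (c , K◁Q) = c , ◁⇒≪ {K} {Q} K◁Q

    from : ∀ Q → Compact ∩ (_≪ Q) ⊆ Compact ∩ (_◁ Q)
    from Q {K} (c , K≪Q) = c , ≪⇒◁ {K} {Q} K≪Q

    enough : ∀ Q M → ⟦ M ⟧ ⊆ proj₁ Q →
             Σ[ K ∈ Concept ] K ∈ Compact × K ◁ Q × ⟦ M ⟧ ⊆ proj₁ K
    enough Q M M⊆Q =
      let F , F∈𝓕 , M⊆⌈F⌉ , ⌈F⌉⊆Q = proj₂ Q M M⊆Q
          -- Interpolation applies only to members of `𝓕`, so `M` is first replaced by `G`.
          G , G∈𝓕 , M⊆⌈G⌉ , G⊆⌈F⌉ = 𝓕-consistent F∈𝓕 M M⊆⌈F⌉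
          H , H∈𝓕 , G⊆⌈H⌉ , H⊆⌈H⌉ , H⊆⌈F⌉ = interpolate F G F∈𝓕 G∈𝓕 G⊆⌈F⌉
          K = ⌈⌉-concept H∈𝓕
      in K , ◁⇒≪ {K} {K} (H , H∈𝓕 , id , H⊆⌈H⌉) , (H , H∈𝓕 , id , ⌈F⌉⊆Q ∘ H⊆⌈F⌉) ,
         ⌈⌉-least G⊆⌈H⌉ ∘ M⊆⌈G⌉

proposition3p16 : {ℓ : Level} → ExcludedMiddle (suc ℓ) →
    (ℙ : AttributeContinuousContext ℓ) →
    let open AttributeContinuousContext ℙ in
    IsAlgebraicDomain 𝔅 ⇔
    (∀ F₁ F₂ → F₁ ∈ 𝓕 → F₂ ∈ 𝓕 → ⟦ F₂ ⟧ ⊆ ⌈ ⟦ F₁ ⟧ ⌉ →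
    ∃[ F ] F ∈ 𝓕 × ⟦ F₂ ⟧ ⊆ ⌈ ⟦ F ⟧ ⌉ × ⟦ F ⟧ ⊆ ⌈ ⟦ F ⟧ ⌉ × ⟦ F ⟧ ⊆ ⌈ ⟦ F₁ ⟧ ⌉)
proposition3p16 em ℙ = mk⇔ algebraic⇒interpolation interpolation⇒algebraic
  where open Concepts em ℙ
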